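{- Let $T=\{1324, 2143, 2341\}$. Then $$F_T(x)=\frac{1-6x+12x^2-8x^3+3x^4-x^5}{(1-x)(1-3x+x^2)^2}.$$
   Context: $S_n(T)$ denotes the set of permutations $\pi$ of $[n]=\{1,\dots,n\}$ (one-line notation) that avoid every pattern $\tau\in T$, i.e. no subsequence of $\pi$ is order-isomorphic to $\tau$. $F_T(x)=\sum_{n\ge 0}|S_n(T)|x^n$, a formal power series, with $|S_0(T)|=1$. -}

module Defs where

open import Data.Fin.Base as Fin using (Fin; zero; suc; toℕ)
import Data.Fin.Properties as Fin
open import Data.Integer.Base as ℤ using (ℤ; +_; 0ℤ; 1ℤ)
import Data.Integer.Properties as ℤ
open import Data.Integer.Tactic.RingSolver using (solve-∀)
open import Data.List.Base using (List; []; _∷_; allFin; cartesianProductWith; filter; length)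
open import Data.List.Membership.Propositional using (_∈_)
open import Data.List.Membership.Propositional.Properties
  using (∈-allFin; ∈-cartesianProductWith⁺; ∈-filter⁺; ∈-filter⁻)
open import Data.List.Relation.Binary.Sublist.Propositional using (_⊆_)
import Data.List.Relation.Binary.Sublist.DecPropositional as DecSublist
open import Data.List.Relation.Unary.All as All using (All; [])
import Data.List.Relation.Unary.Any as Any
open import Data.List.Relation.Unary.AllPairs using ([]; _∷_)
open import Data.List.Relation.Unary.Unique.Propositional as List using ()
import Data.List.Relation.Unary.Unique.Propositional.Properties as ListUnique
open import Data.Nat.Base as ℕ using (ℕ; zero; suc; _∸_)
import Data.Nat.Properties as ℕ
open import Data.Nat.Induction using (<-rec)
open import Data.Product.Base using (∃; ∃-syntax; _×_; _,_; proj₁; proj₂)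
open import Data.Vec.Base using (Vec; []; _∷_; lookup; toList)
open import Data.Vec.Properties using (∷-injective)
open import Data.Vec.Relation.Unary.AllPairs using (allPairs?)
open import Data.Vec.Relation.Unary.Unique.Propositional using (Unique)
open import Function.Base using (_∘_)
open import Function.Bundles using (_⇔_; mk⇔; Equivalence)
open import Relation.Binary.PropositionalEquality
open import Relation.Nullary.Decidable using (Dec; map′; ¬?; _×-dec_; _→-dec_)
open import Relation.Nullary.Negation using (¬_)

open import Algebra.Definitions.RawMonoid ℤ.+-0-rawMonoid using (sum)
open import Algebra.Properties.Monoid.Sum ℤ.+-0-monoid using (sum-cong-≗)

private
  variable
    k m n : ℕ

-- The set [n] is represented by Fin n, so values are shifted down by one:
-- the permutation 1324 is 0F ∷ 2F ∷ 1F ∷ 3F ∷ [].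

OneLine : ℕ → Set
OneLine n = Vec (Fin n) n

-- For words of length n over an n-letter alphabet, having no repeated
-- letter is the same as being a permutation.

IsPermutation : OneLine n → Set
IsPermutation π = Unique π

OrderIsomorphic : Vec (Fin m) k → Vec (Fin n) k → Set
OrderIsomorphic σ τ =
  ∀ i j → lookup σ i Fin.< lookup σ j ⇔ lookup τ i Fin.< lookup τ j

Contains : OneLine n → OneLine k → Set
Contains {n} {k} π τ =
  ∃[ σ ] toList {n = k} σ ⊆ toList π × OrderIsomorphic {n} σ τ

Pattern : Set
Pattern = ∃ OneLine

Avoids : List Pattern → OneLine n → Set
Avoids T π = All (λ (_ , τ) → ¬ Contains π τ) T

isPermutation? : (π : OneLine n) → Dec (IsPermutation π)
isPermutation? = allPairs? (λ x y → ¬? (x Fin.≟ y))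

orderIsomorphic? : (σ : Vec (Fin m) k) (τ : Vec (Fin n) k) → Dec (OrderIsomorphic σ τ)
orderIsomorphic? σ τ = Fin.all? λ i → Fin.all? λ j →
  (lookup σ i Fin.<? lookup σ j) ⇔-dec (lookup τ i Fin.<? lookup τ j)
  where
  _⇔-dec_ : {A B : Set} → Dec A → Dec B → Dec (A ⇔ B)
  a? ⇔-dec b? = map′ (λ (f , g) → mk⇔ f g) (λ e → Equivalence.to e , Equivalence.from e)
    ((a? →-dec b?) ×-dec (b? →-dec a?))

anyWord? : {P : Vec (Fin n) k → Set} → (∀ σ → Dec (P σ)) → Dec (∃ P)
anyWord? {k = zero}  P? = map′ ([] ,_) (λ { ([] , p) → p }) (P? [])
anyWord? {k = suc k} P? =
  map′ (λ (x , σ , p) → x ∷ σ , p) (λ { (x ∷ σ , p) → x , σ , p })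
    (Fin.any? λ x → anyWord? (P? ∘ (x ∷_)))

contains? : (π : OneLine n) (τ : OneLine k) → Dec (Contains π τ)
contains? π τ = anyWord? λ σ → (toList σ ⊆? toList π) ×-dec orderIsomorphic? σ τ
  where open DecSublist Fin._≟_ using (_⊆?_)

avoids? : (T : List Pattern) (π : OneLine n) → Dec (Avoids T π)
avoids? T π = All.all? (λ (_ , τ) → ¬? (contains? π τ)) T

words : ∀ n k → List (Vec (Fin n) k)
words n zero    = [] ∷ []
words n (suc k) = cartesianProductWith _∷_ (allFin n) (words n k)

S : ∀ n → List Pattern → List (OneLine n)
S n T = filter (λ π → isPermutation? π ×-dec avoids? T π) (words n n)

-- S n T lists every T-avoiding permutation of [n] exactly once.

∈-words : (σ : Vec (Fin n) k) → σ ∈ words n k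
∈-words []      = Any.here refl
∈-words (x ∷ σ) = ∈-cartesianProductWith⁺ _∷_ (∈-allFin x) (∈-words σ)

words-unique : ∀ n k → List.Unique (words n k)
words-unique n zero    = [] ∷ []
words-unique n (suc k) =
  ListUnique.cartesianProductWith⁺ _∷_ ∷-injective (ListUnique.allFin⁺ n) (words-unique n k)

∈-S⇔ : ∀ T (π : OneLine n) → π ∈ S n T ⇔ (IsPermutation π × Avoids T π)
∈-S⇔ T π = mk⇔ (proj₂ ∘ ∈-filter⁻ P? {xs = words _ _}) (∈-filter⁺ P? (∈-words π))
  where P? = λ π → isPermutation? π ×-dec avoids? T π

S-unique : ∀ n T → List.Unique (S n T)
S-unique n T =
  ListUnique.filter⁺ (λ π → isPermutation? π ×-dec avoids? T π) (words-unique n n)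

-- Formal power series over ℤ by coefficients; equality is pointwise, _≗_.

PowerSeries : Set
PowerSeries = ℕ → ℤ

poly : List ℤ → PowerSeries
poly []       _       = 0ℤ
poly (a ∷ as) zero    = a
poly (a ∷ as) (suc n) = poly as n

infixl 7 _*_ _/_
infixr 8 _^_

_*_ : PowerSeries → PowerSeries → PowerSeries
(p * q) n = sum {suc n} λ i → p (toℕ i) ℤ.* q (n ∸ toℕ i)

_^_ : PowerSeries → ℕ → PowerSeries
p ^ zero  = poly (1ℤ ∷ [])
p ^ suc k = p * p ^ k

-- Long division by a series with constant coefficient 1: the quotient h
-- has h n = p n - (q 1 * h (n - 1) + … + q n * h 0). The vector holds the
-- n coefficients h (n - 1) , … , h 0.

quotientStep : (p q : PowerSeries) → Vec ℤ n → ℤ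
quotientStep {n} p q h = p n ℤ.- sum λ i → q (suc (toℕ i)) ℤ.* lookup h i

quotientPrefix : (p q : PowerSeries) → ∀ n → Vec ℤ n
quotientPrefix p q zero    = []
quotientPrefix p q (suc n) = quotientStep p q h ∷ h
  where h = quotientPrefix p q n

_/_ : (p q : PowerSeries) .{{_ : q 0 ≡ 1ℤ}} → PowerSeries
(p / q) n = quotientStep p q (quotientPrefix p q n)

instance
  1≡1 : 1ℤ ≡ 1ℤ
  1≡1 = refl

-- p / q is the unique series whose product with q is p.

module _ (p q : PowerSeries) {{q₀≡1 : q 0 ≡ 1ℤ}} where

  private
    lookup-prefix : ∀ n (i : Fin n) →
      lookup (quotientPrefix p q n) i ≡ (p / q) (n ∸ suc (toℕ i))
    lookup-prefix (suc n) zero    = refl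
    lookup-prefix (suc n) (suc i) = lookup-prefix n i

    tailSum : PowerSeries → ℕ → ℤ
    tailSum h n = sum {n} λ i → q (suc (toℕ i)) ℤ.* h (n ∸ suc (toℕ i))

    quotient-step : ∀ n → (p / q) n ≡ p n ℤ.- tailSum (p / q) n
    quotient-step n = cong (λ s → p n ℤ.- s)
      (sum-cong-≗ λ i → cong (q (suc (toℕ i)) ℤ.*_) (lookup-prefix n i))

    product-step : ∀ h n → (q * h) n ≡ h n ℤ.+ tailSum h n
    product-step h n =
      cong (ℤ._+ tailSum h n) (trans (cong (ℤ._* h n) q₀≡1) (ℤ.*-identityˡ (h n)))

    [a-b]+b : ∀ a b → (a ℤ.- b) ℤ.+ b ≡ a
    [a-b]+b = solve-∀

    [a+b]-b : ∀ a b → (a ℤ.+ b) ℤ.- b ≡ a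
    [a+b]-b = solve-∀

  *-/-cancel : q * (p / q) ≗ p
  *-/-cancel n = trans (product-step (p / q) n)
    (trans (cong (ℤ._+ tailSum (p / q) n) (quotient-step n)) ([a-b]+b (p n) _))

  /-unique : ∀ h → q * h ≗ p → h ≗ p / q
  /-unique h qh≗p = <-rec _ step
    where
    step : ∀ n → (∀ {m} → m ℕ.< n → h m ≡ (p / q) m) → h n ≡ (p / q) n
    step n rec = trans (sym ([a+b]-b (h n) (tailSum h n)))
      (trans (cong₂ ℤ._-_ (trans (sym (product-step h n)) (qh≗p n)) tails)
             (sym (quotient-step n)))
      where
      tails : tailSum h n ≡ tailSum (p / q) n
      tails = sum-cong-≗ λ i → cong (q (suc (toℕ i)) ℤ.*_)
        (rec (ℕ.∸-monoʳ-< {n} ℕ.z<s (Fin.toℕ<n i)))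

F : List Pattern → PowerSeries
F T n = + length (S n T)

{-# OPTIONS --safe #-}
module Submission where

-- Let the maximum of an avoider be neither its first nor its last letter.
-- Such a maximum in second position can be deleted freely; otherwise the
-- first letter must be the minimum or the second largest letter, and it can
-- be deleted too (a deleted minimum leaves a {213, 2341}-avoider). A maximum
-- in first position can also be deleted freely, and one in last position
-- leaves a {132, 2341}-avoider. The two auxiliary classes decompose in the
-- same way, so all counts satisfy a linear system of recurrences.

open import Defs
open import Data.Empty using (⊥; ⊥-elim)
open import Data.Fin.Base as Fin
  using (Fin; zero; suc; toℕ; fromℕ; inject₁; punchIn; punchOut; _<_)
import Data.Fin.Properties as Fin
open import Data.Fin.Patterns using (0F; 1F; 2F; 3F)
open import Data.Integer.Base as ℤ using (ℤ; +_; -_; 0ℤ; 1ℤ)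
import Data.Integer.Properties as ℤ
open import Data.Integer.Tactic.RingSolver using (solve-∀)
open import Data.List.Base as List using (List; []; _∷_; _++_; length)
open import Data.List.Membership.Propositional using (_∈_)
open import Data.List.Membership.Propositional.Properties
  using (∈-map⁺; ∈-map⁻; ∈-++⁺ˡ; ∈-++⁺ʳ; ∈-++⁻)
open import Data.List.Membership.Propositional.Properties.WithK using (unique∧set⇒bag)
open import Data.List.Properties using (length-++; length-map)
open import Data.List.Relation.Binary.BagAndSetEquality using (∼bag⇒↭)
open import Data.List.Relation.Binary.Permutation.Propositional.Properties using (↭-length)
open import Data.List.Relation.Binary.Sublist.Propositional using (_⊆_; []; _∷_; _∷ʳ_; minimum)
open import Data.List.Relation.Unary.All using ([]; _∷_)
open import Data.List.Relation.Unary.Any using (here)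
open import Data.List.Relation.Unary.AllPairs using ([]; _∷_)
open import Data.List.Relation.Unary.Unique.Propositional as List using ()
import Data.List.Relation.Unary.Unique.Propositional.Properties as ListUnique
open import Data.Nat.Base as ℕ using (ℕ; zero; suc; _∸_; z<s; s<s)
import Data.Nat.Properties as ℕ
open import Data.Product.Base using (∃-syntax; _×_; _,_; proj₁; proj₂)
open import Data.Product.Function.NonDependent.Propositional using (_×-⇔_)
open import Data.Sum.Base as Sum using (_⊎_; inj₁; inj₂; [_,_]′)
open import Data.Vec.Base using (Vec; []; _∷_; lookup; toList; tabulate; map; insertAt)
open import Data.Vec.Properties
  using (lookup-map; lookup∘tabulate; tabulate∘lookup; tabulate-cong
        ; insertAt-lookup; insertAt-punchIn; removeAt-punchOut)
open import Data.Vec.Relation.Unary.AllPairs using ([])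
open import Data.Vec.Relation.Unary.Linked as Linked using (Linked; [-]; _∷_)
import Data.Vec.Relation.Unary.Linked.Properties as Linked
open import Data.Vec.Relation.Unary.Unique.Propositional using (Unique)
open import Data.Vec.Relation.Unary.Unique.Propositional.Properties
  using (lookup-injective; tabulate⁺)
open import Function.Base using (_∘_; id)
open import Function.Bundles using (_⇔_; mk⇔; Equivalence)
open import Function.Definitions using (Injective)
open import Relation.Binary.Definitions using (tri<; tri≈; tri>)
open import Relation.Binary.PropositionalEquality
open import Relation.Nullary.Decidable using (yes; no; toWitness)
open import Relation.Nullary.Negation using (¬_; contradiction)

open import Algebra.Properties.Monoid.Sum ℤ.+-0-monoid using (sum-cong-≗; sum-replicate-zero)

open Equivalence using (to; from)

-- A deletion is free when no occurrence of a pattern can use the letter. A letter in first, second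
-- or last position can play only the matching few letters of a pattern, so freeness is a comparison
-- inside the pattern: none of 1324, 2143, 2341 has its largest letter in first or second place, and
-- each starts with a letter that has two larger ones. The exceptions are the 1 that opens 1324 and
-- the 4 that closes it; they produce 213 and 132.
--
-- The obstacle is that a deletion moves the maximum relative to the ends, so its place must be
-- tracked. Deleting a smaller first letter turns "maximum not second" into "maximum not first" and
-- keeps "maximum not last". Hence the classes with the maximum away from both ends reproduce
-- themselves, and the system closes.

private
  variable
    A : Set
    P Q : A → Set
    a b k l m n : ℕ

-- Order on Fin and punchIn

-- Both the largest value and the last position.
max : Fin (suc n)
max = fromℕ _

second-max : Fin (suc (suc n))
second-max = inject₁ max

≢zero⇒zero< : {i : Fin (suc n)} → i ≢ zero → zero {n} < i
≢zero⇒zero< {i = zero}  i≢0 = contradiction refl i≢0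
≢zero⇒zero< {i = suc _} _   = z<s

≢zero∧≢one⇒one< : {i : Fin (suc (suc n))} → i ≢ zero → i ≢ suc zero → suc (zero {n}) < i
≢zero∧≢one⇒one< {i = zero}  i≢0 _ = contradiction refl i≢0
≢zero∧≢one⇒one< {i = suc i} _ i≢1 = s<s (≢zero⇒zero< (i≢1 ∘ cong suc))

≢max⇒<max : {i : Fin (suc n)} → i ≢ max → i < max
≢max⇒<max {i = i} = Fin.≤∧≢⇒< (Fin.≤fromℕ i)

≢max⇒inject₁ : {i : Fin (suc n)} → i ≢ max → ∃[ j ] i ≡ inject₁ j
≢max⇒inject₁ {zero}  {zero}  i≢max = contradiction refl i≢max
≢max⇒inject₁ {suc n} {zero}  i≢max = zero , refl
≢max⇒inject₁ {suc n} {suc i} i≢max with j , refl ← ≢max⇒inject₁ (i≢max ∘ cong suc) = suc j , refl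

inject₁-mono-< : {i j : Fin n} → i < j → inject₁ i < inject₁ j
inject₁-mono-< {i = i} {j} = subst₂ ℕ._<_ (sym (Fin.toℕ-inject₁ i)) (sym (Fin.toℕ-inject₁ j))

≢max∧≢second⇒<second : {i : Fin (suc (suc n))} → i ≢ max → i ≢ second-max → i < second-max
≢max∧≢second⇒<second i≢max i≢sec with j , refl ← ≢max⇒inject₁ i≢max =
  inject₁-mono-< (≢max⇒<max (i≢sec ∘ cong inject₁))

second≢max : second-max {n} ≢ max
second≢max = Fin.fromℕ≢inject₁ ∘ sym

¬second<i<max : {i : Fin (suc (suc n))} → ¬ (second-max < i × i < max)
¬second<i<max {i = i} (sec<i , i<max) with j , refl ← ≢max⇒inject₁ (Fin.<⇒≢ i<max) =
  ℕ.<⇒≱ sec<i (subst₂ ℕ._≤_ (sym (Fin.toℕ-inject₁ j)) (sym (Fin.toℕ-inject₁ _)) (Fin.≤fromℕ j))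

punchIn-mono-< : ∀ i {j k : Fin n} → j < k → punchIn i j < punchIn i k
punchIn-mono-< i j<k = ℕ.≰⇒> (ℕ.<⇒≱ j<k ∘ Fin.punchIn-cancel-≤ i _ _)

punchIn-cancel-< : ∀ i {j k : Fin n} → punchIn i j < punchIn i k → j < k
punchIn-cancel-< i pj<pk = ℕ.≰⇒> (ℕ.<⇒≱ pj<pk ∘ Fin.punchIn-mono-≤ i _ _)

punchOut-mono-< : {i j k : Fin (suc n)} (i≢j : i ≢ j) (i≢k : i ≢ k) →
  j < k → punchOut i≢j < punchOut i≢k
punchOut-mono-< i≢j i≢k j<k = ℕ.≰⇒> (ℕ.<⇒≱ j<k ∘ Fin.punchOut-cancel-≤ i≢k i≢j)

punchIn-max : {i : Fin (suc (suc n))} → i ≢ max → punchIn i max ≡ max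
punchIn-max {zero}  {zero}     i≢max = refl
punchIn-max {zero}  {suc zero} i≢max = contradiction refl i≢max
punchIn-max {suc n} {zero}     i≢max = refl
punchIn-max {suc n} {suc i}    i≢max = cong suc (punchIn-max (i≢max ∘ cong suc))

-- Permutations

module _ {π : OneLine n} (perm : IsPermutation π) where

  lookup-≢ : ∀ {i j} → i ≢ j → lookup π i ≢ lookup π j
  lookup-≢ i≢j = i≢j ∘ lookup-injective perm _ _

  lookup-cmp : ∀ {i j} → i ≢ j → lookup π i < lookup π j ⊎ lookup π j < lookup π i
  lookup-cmp {i} {j} i≢j with Fin.<-cmp (lookup π i) (lookup π j)
  ... | tri< πi<πj _ _ = inj₁ πi<πj
  ... | tri≈ _ πi≡πj _ = contradiction πi≡πj (lookup-≢ i≢j)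
  ... | tri> _ _ πj<πi = inj₂ πj<πi

-- Pigeonhole: punching out a missed value would inject `Fin (suc n)` into `Fin n`.
lookup-surjective : {π : OneLine n} → IsPermutation π → ∀ v → ∃[ i ] lookup π i ≡ v
lookup-surjective {suc n} {π} perm v with Fin.any? (λ i → lookup π i Fin.≟ v)
... | yes hit = hit
... | no miss = contradiction (Fin.injective⇒≤ punched) (ℕ.<⇒≱ ℕ.≤-refl)
  where
  v≢ : ∀ i → v ≢ lookup π i
  v≢ i v≡ = miss (i , sym v≡)
  punched : Injective _≡_ _≡_ (λ i → punchOut (v≢ i))
  punched eq = lookup-injective perm _ _ (Fin.punchOut-injective (v≢ _) (v≢ _) eq)

lookup-ext : {xs ys : Vec A n} → (∀ i → lookup xs i ≡ lookup ys i) → xs ≡ ys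
lookup-ext {xs = xs} {ys} eq =
  trans (sym (tabulate∘lookup xs)) (trans (tabulate-cong eq) (tabulate∘lookup ys))

-- The inverse of deleting a letter and standardising the rest. For fixed `p` and `v` it is a
-- bijection from permutations onto the permutations with `v` at `p`, which is the form that
-- counting uses.
insert : Fin (suc n) → Fin (suc n) → OneLine n → OneLine (suc n)
insert p v ρ = insertAt (map (punchIn v) ρ) p v

module _ (p v : Fin (suc n)) where

  lookup-insert : ∀ ρ → lookup (insert p v ρ) p ≡ v
  lookup-insert ρ = insertAt-lookup (map (punchIn v) ρ) p v

  lookup-insert-punchIn : ∀ ρ j → lookup (insert p v ρ) (punchIn p j) ≡ punchIn v (lookup ρ j)
  lookup-insert-punchIn ρ j =
    trans (insertAt-punchIn (map (punchIn v) ρ) p v j) (lookup-map j (punchIn v) ρ)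

  lookup-insert-punchIn-≢ : ∀ ρ j → lookup (insert p v ρ) (punchIn p j) ≢ v
  lookup-insert-punchIn-≢ ρ j eq =
    Fin.punchInᵢ≢i v (lookup ρ j) (trans (sym (lookup-insert-punchIn ρ j)) eq)

  insert-injective : Injective _≡_ _≡_ (insert p v)
  insert-injective {ρ} {ρ′} eq = lookup-ext λ j → Fin.punchIn-injective v _ _
    (trans (sym (lookup-insert-punchIn ρ j))
      (trans (cong (λ π → lookup π (punchIn p j)) eq) (lookup-insert-punchIn ρ′ j)))

  position-view : ∀ j → p ≡ j ⊎ ∃[ j′ ] j ≡ punchIn p j′
  position-view j with p Fin.≟ j
  ... | yes p≡j = inj₁ p≡j
  ... | no p≢j = inj₂ (punchOut p≢j , sym (Fin.punchIn-punchOut p≢j))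

  insert-permutation : ∀ {ρ} → IsPermutation ρ → IsPermutation (insert p v ρ)
  insert-permutation {ρ} perm =
    subst Unique (tabulate∘lookup (insert p v ρ)) (tabulate⁺ (λ {i} {j} → injective i j))
    where
    π = insert p v ρ
    injective : ∀ i j → lookup π i ≡ lookup π j → i ≡ j
    injective i j eq with position-view i | position-view j
    ... | inj₁ refl | inj₁ refl = refl
    ... | inj₁ refl | inj₂ (j′ , refl) =
      contradiction (trans (sym eq) (lookup-insert ρ)) (lookup-insert-punchIn-≢ ρ j′)
    ... | inj₂ (i′ , refl) | inj₁ refl =
      contradiction (trans eq (lookup-insert ρ)) (lookup-insert-punchIn-≢ ρ i′)
    ... | inj₂ (i′ , refl) | inj₂ (j′ , refl) =
      cong (punchIn p) (lookup-injective perm i′ j′ (Fin.punchIn-injective v _ _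
        (trans (sym (lookup-insert-punchIn ρ i′)) (trans eq (lookup-insert-punchIn ρ j′)))))

  insert-surjective : ∀ {π} → IsPermutation π → lookup π p ≡ v →
    ∃[ ρ ] IsPermutation ρ × π ≡ insert p v ρ
  insert-surjective {π} perm πp≡v = ρ , tabulate⁺ injective , lookup-ext agree
    where
    v≢ : ∀ j → v ≢ lookup π (punchIn p j)
    v≢ j v≡ = Fin.punchInᵢ≢i p j (lookup-injective perm _ _ (trans (sym v≡) (sym πp≡v)))
    ρ = tabulate (λ j → punchOut (v≢ j))
    injective : ∀ {i j} → punchOut (v≢ i) ≡ punchOut (v≢ j) → i ≡ j
    injective eq = Fin.punchIn-injective p _ _
      (lookup-injective perm _ _ (Fin.punchOut-injective (v≢ _) (v≢ _) eq))
    agree : ∀ i → lookup π i ≡ lookup (insert p v ρ) i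
    agree i with position-view i
    ... | inj₁ refl = trans πp≡v (sym (lookup-insert ρ))
    ... | inj₂ (j , refl) = sym (trans (lookup-insert-punchIn ρ j)
      (trans (cong (punchIn v) (lookup∘tabulate _ j)) (Fin.punchIn-punchOut (v≢ j))))

-- Occurrences of patterns

Increasing : (Fin k → Fin l) → Set
Increasing e = ∀ {i j} → i < j → e i < e j

-- Containment as an embedding of positions, so that occurrences compose and a pattern inside a
-- pattern is again an occurrence. Preserving the order in one direction suffices: for a permutation
-- `τ` the converse follows by trichotomy.
record Occurrence (τ : Vec (Fin m) k) (π : Vec (Fin n) l) : Set where
  field
    position : Fin k → Fin l
    mono     : Increasing position
    order    : ∀ {i j} → lookup τ i < lookup τ j → lookup π (position i) < lookup π (position j)

open Occurrence

letter : {τ : Vec (Fin m) k} {π : Vec (Fin n) l} → Occurrence τ π → Fin k → Fin n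
letter {π = π} o i = lookup π (position o i)

Avoid : OneLine k → OneLine n → Set
Avoid τ π = ¬ Occurrence τ π

compose : {σ : Vec (Fin m) k} {τ : Vec (Fin n) l} {π : Vec (Fin a) b} →
  Occurrence σ τ → Occurrence τ π → Occurrence σ π
compose o o′ = record
  { position = position o′ ∘ position o
  ; mono     = mono o′ ∘ mono o
  ; order    = order o′ ∘ order o
  }

sublist-positions : (σ : Vec A k) (π : Vec A l) → toList σ ⊆ toList π →
  ∃[ e ] Increasing {k} {l} e × (∀ i → lookup σ i ≡ lookup π (e i))
sublist-positions [] π s = (λ ()) , (λ { {()} }) , λ ()
sublist-positions (x ∷ σ) (y ∷ π) (.y ∷ʳ s) with e , mono , eq ← sublist-positions (x ∷ σ) π s =
  suc ∘ e , s<s ∘ mono , eq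
sublist-positions (x ∷ σ) (y ∷ π) (x≡y ∷ s) with e , mono , eq ← sublist-positions σ π s =
  e′ , mono′ , eq′
  where
  e′ : Fin (suc _) → Fin (suc _)
  e′ zero    = zero
  e′ (suc i) = suc (e i)
  mono′ : Increasing e′
  mono′ {zero}  {suc j} _       = z<s
  mono′ {suc i} {suc j} (s<s i<j) = s<s (mono i<j)
  eq′ : ∀ i → lookup (x ∷ σ) i ≡ lookup (y ∷ π) (e′ i)
  eq′ zero    = x≡y
  eq′ (suc i) = eq i

-- Recursion on `π`: its head is matched if `e` starts at `zero` and skipped otherwise. In both
-- cases the positions still to be placed are nonzero because `e` increases, so punching out `zero`
-- lowers them all by one.
positions-sublist : (σ : Vec A k) (π : Vec A l) (e : Fin k → Fin l) →
  Increasing e → (∀ i → lookup σ i ≡ lookup π (e i)) → toList σ ⊆ toList π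
positions-sublist []      π       e mono eq = minimum _
positions-sublist (x ∷ σ) []      e mono eq with () ← e zero
positions-sublist (x ∷ σ) (y ∷ π) e mono eq with e zero Fin.≟ zero
... | yes e0≡0 = trans (eq zero) (cong (lookup (y ∷ π)) e0≡0) ∷
  positions-sublist σ π (λ i → punchOut (0≢ i)) (λ i<j → punchOut-mono-< (0≢ _) (0≢ _) (mono (s<s i<j)))
    (λ i → trans (eq (suc i)) (sym (removeAt-punchOut (y ∷ π) (0≢ i))))
  where
  0≢ : ∀ i → zero ≢ e (suc i)
  0≢ i 0≡ = ℕ.<⇒≢ (mono {zero} {suc i} z<s) (cong toℕ (trans e0≡0 0≡))
... | no e0≢0 = y ∷ʳ
  positions-sublist (x ∷ σ) π (λ i → punchOut (0≢ i)) (λ i<j → punchOut-mono-< (0≢ _) (0≢ _) (mono i<j))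
    (λ i → trans (eq i) (sym (removeAt-punchOut (y ∷ π) (0≢ i))))
  where
  0≢ : ∀ i → zero ≢ e i
  0≢ zero    0≡ = e0≢0 (sym 0≡)
  0≢ (suc i) 0≡ with () ← subst (e zero <_) (sym 0≡) (mono {zero} {suc i} z<s)

contains⇔occurrence : {π : OneLine n} {τ : OneLine k} → IsPermutation τ → Contains π τ ⇔ Occurrence τ π
contains⇔occurrence {π = π} {τ} perm = mk⇔ there back
  where
  there : Contains π τ → Occurrence τ π
  there (σ , σ⊆π , iso) with e , mono , eq ← sublist-positions σ π σ⊆π = record
    { position = e
    ; mono     = mono
    ; order    = λ {i} {j} τi<τj → subst₂ _<_ (eq i) (eq j) (from (iso i j) τi<τj)
    }
  back : Occurrence τ π → Contains π τ
  back o = σ , positions-sublist σ π (position o) (mono o) eq , λ i j → mk⇔ (reflects i j) (preserves i j)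
    where
    σ = tabulate (lookup π ∘ position o)
    eq = lookup∘tabulate (lookup π ∘ position o)
    preserves : ∀ i j → lookup τ i < lookup τ j → lookup σ i < lookup σ j
    preserves i j τi<τj = subst₂ _<_ (sym (eq i)) (sym (eq j)) (order o τi<τj)
    reflects : ∀ i j → lookup σ i < lookup σ j → lookup τ i < lookup τ j
    reflects i j σi<σj with i Fin.≟ j
    ... | yes refl = contradiction σi<σj (ℕ.<-irrefl refl)
    ... | no i≢j = [ id , (λ τj<τi → contradiction σi<σj (ℕ.<-asym (preserves j i τj<τi))) ]′
      (lookup-cmp perm i≢j)

-- The positions e carry the pattern whose inverse permutation is ι.
occurrence : {π : OneLine n} (τ ι : OneLine k) → (∀ i → lookup ι (lookup τ i) ≡ i) →
  (e : Vec (Fin n) k) → Linked _<_ e → Linked _<_ (map (lookup π ∘ lookup e) ι) → Occurrence τ π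
occurrence {π = π} τ ι inverse e positions values = record
  { position = lookup e
  ; mono     = Linked.lookup⁺ ℕ.<-trans positions
  ; order    = λ {i} {j} τi<τj → subst₂ _<_ (value i) (value j) (Linked.lookup⁺ ℕ.<-trans values τi<τj)
  }
  where
  value : ∀ i → lookup (map (lookup π ∘ lookup e) ι) (lookup τ i) ≡ lookup π (lookup e i)
  value i = trans (lookup-map (lookup τ i) _ ι) (cong (lookup π ∘ lookup e) (inverse i))

⟨132⟩ ⟨213⟩ : OneLine 3
⟨132⟩ = 0F ∷ 2F ∷ 1F ∷ []
⟨213⟩ = 1F ∷ 0F ∷ 2F ∷ []

⟨1324⟩ ⟨2143⟩ ⟨2341⟩ : OneLine 4
⟨1324⟩ = 0F ∷ 2F ∷ 1F ∷ 3F ∷ []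
⟨2143⟩ = 1F ∷ 0F ∷ 3F ∷ 2F ∷ []
⟨2341⟩ = 1F ∷ 2F ∷ 3F ∷ 0F ∷ []

module _ {π : OneLine n} where

  private
    _≺_ : Fin n → Fin n → Set
    i ≺ j = lookup π i < lookup π j

  module _ {p q r : Fin n} (p<q : p < q) (q<r : q < r) where

    occurrence-132 : p ≺ r → r ≺ q → Occurrence ⟨132⟩ π
    occurrence-132 v₁ v₂ = occurrence ⟨132⟩ ⟨132⟩ (λ { 0F → refl ; 1F → refl ; 2F → refl })
      (p ∷ q ∷ r ∷ []) (p<q ∷ q<r ∷ [-]) (v₁ ∷ v₂ ∷ [-])

    occurrence-213 : q ≺ p → p ≺ r → Occurrence ⟨213⟩ π
    occurrence-213 v₁ v₂ = occurrence ⟨213⟩ ⟨213⟩ (λ { 0F → refl ; 1F → refl ; 2F → refl })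
      (p ∷ q ∷ r ∷ []) (p<q ∷ q<r ∷ [-]) (v₁ ∷ v₂ ∷ [-])

  module _ {p q r s : Fin n} (p<q : p < q) (q<r : q < r) (r<s : r < s) where

    occurrence-1324 : p ≺ r → r ≺ q → q ≺ s → Occurrence ⟨1324⟩ π
    occurrence-1324 v₁ v₂ v₃ = occurrence ⟨1324⟩ ⟨1324⟩ (λ { 0F → refl ; 1F → refl ; 2F → refl ; 3F → refl })
      (p ∷ q ∷ r ∷ s ∷ []) (p<q ∷ q<r ∷ r<s ∷ [-]) (v₁ ∷ v₂ ∷ v₃ ∷ [-])

    occurrence-2143 : q ≺ p → p ≺ s → s ≺ r → Occurrence ⟨2143⟩ π
    occurrence-2143 v₁ v₂ v₃ = occurrence ⟨2143⟩ ⟨2143⟩ (λ { 0F → refl ; 1F → refl ; 2F → refl ; 3F → refl })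
      (p ∷ q ∷ r ∷ s ∷ []) (p<q ∷ q<r ∷ r<s ∷ [-]) (v₁ ∷ v₂ ∷ v₃ ∷ [-])

    occurrence-2341 : s ≺ p → p ≺ q → q ≺ r → Occurrence ⟨2341⟩ π
    -- The other four patterns are involutions and serve as their own inverses; the inverse of 2341
    -- is 4123.
    occurrence-2341 v₁ v₂ v₃ = occurrence ⟨2341⟩ (3F ∷ 0F ∷ 1F ∷ 2F ∷ [])
      (λ { 0F → refl ; 1F → refl ; 2F → refl ; 3F → refl })
      (p ∷ q ∷ r ∷ s ∷ []) (p<q ∷ q<r ∷ r<s ∷ [-]) (v₁ ∷ v₂ ∷ v₃ ∷ [-])

-- Removing a letter

module _ {p v : Fin (suc n)} {ρ : OneLine n} where

  insert-occurrence : Occurrence ρ (insert p v ρ)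
  insert-occurrence = record
    { position = punchIn p
    ; mono     = punchIn-mono-< p
    ; order    = λ ρi<ρj → subst₂ _<_ (sym (lookup-insert-punchIn p v ρ _))
                   (sym (lookup-insert-punchIn p v ρ _)) (punchIn-mono-< v ρi<ρj)
    }

  restrict : {τ : OneLine k} (o : Occurrence τ (insert p v ρ)) → (∀ i → p ≢ position o i) →
    Occurrence τ ρ
  restrict o p≢ = record
    { position = λ i → punchOut (p≢ i)
    ; mono     = λ i<j → punchOut-mono-< (p≢ _) (p≢ _) (mono o i<j)
    ; order    = λ τi<τj → punchIn-cancel-< v (subst₂ _<_ (value _) (value _) (order o τi<τj))
    }
    where
    value : ∀ i → lookup (insert p v ρ) (position o i) ≡ punchIn v (lookup ρ (punchOut (p≢ i)))
    value i = trans (cong (lookup (insert p v ρ)) (sym (Fin.punchIn-punchOut (p≢ i))))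
      (lookup-insert-punchIn p v ρ _)

-- Only this direction depends on the pattern; the converse is always given by `insert-occurrence`.
Removable : Fin (suc n) → Fin (suc n) → OneLine k → Set
Removable {n} p v τ = {ρ : OneLine n} → Occurrence τ (insert p v ρ) → Occurrence τ ρ

module _ (p v : Fin (suc n)) {τ : OneLine k} where

  removable : ({π : OneLine (suc n)} (o : Occurrence τ π) →
    ∀ i → position o i ≡ p → letter o i ≢ v) → Removable p v τ
  removable misses {ρ} o = restrict o λ i p≡ →
    misses o i (sym p≡) (trans (cong (lookup (insert p v ρ)) (sym p≡)) (lookup-insert p v ρ))

  avoid-insert : Removable p v τ → ∀ ρ → Avoid τ (insert p v ρ) ⇔ Avoid τ ρ
  avoid-insert rem ρ = mk⇔ (λ av o → av (compose o insert-occurrence)) (λ av o → av (rem o))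

module _ {τ : OneLine (suc k)} {π : OneLine (suc n)} (o : Occurrence τ π) where

  position-first : ∀ i → position o i ≡ zero → i ≡ zero
  position-first zero    _  = refl
  position-first (suc i) eq with () ← subst (position o zero <_) eq (mono o z<s)

  position-last : ∀ i → position o i ≡ max → i ≡ max
  position-last i eq with i Fin.≟ max
  ... | yes i≡max = i≡max
  ... | no i≢max = contradiction (Fin.≤fromℕ (position o max))
    (ℕ.<⇒≱ (subst (_< position o max) eq (mono o (≢max⇒<max i≢max))))

  below-max : ∀ {i j} → lookup τ i < lookup τ j → letter o i ≢ max
  below-max τi<τj eq = ℕ.<⇒≱ (subst (_< _) eq (order o τi<τj)) (Fin.≤fromℕ _)

  above-zero : ∀ {i j} → lookup τ j < lookup τ i → letter o i ≢ zero
  above-zero τj<τi eq with () ← subst (_ <_) eq (order o τj<τi)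

position-second : {τ : OneLine (suc (suc k))} {π : OneLine (suc (suc n))} (o : Occurrence τ π) →
  ∀ i → position o i ≡ suc zero → i ≡ zero ⊎ i ≡ suc zero
position-second o zero          _  = inj₁ refl
position-second o (suc zero)    _  = inj₂ refl
position-second o (suc (suc i)) eq = contradiction
  (subst (position o (suc zero) <_) eq (mono o (s<s z<s)))
  (ℕ.≤⇒≯ (ℕ.≤-trans z<s (mono o z<s)))

-- Two letters of the occurrence lie above `letter o h`, but only one value lies above `second-max`.
below-second-max : {τ : OneLine k} {π : OneLine (suc (suc n))} (o : Occurrence τ π) →
  ∀ {h i j} → lookup τ h < lookup τ i → lookup τ i < lookup τ j →
  letter o h ≢ second-max
below-second-max o τh<τi τi<τj eq = ¬second<i<max
  (subst (_< _) eq (order o τh<τi) , ℕ.<-≤-trans (order o τi<τj) (Fin.≤fromℕ _))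

module _ (τ : OneLine (suc k)) where

  -- The first position can be met only by the first letter of `τ`, and the maximum cannot play a
  -- letter that has a larger one. The index `j` is the witness for the larger letter; the next
  -- criteria follow the same scheme.
  first-max-removable : ∀ j → lookup τ zero < lookup τ j → Removable {n} zero max τ
  first-max-removable j τ0<τj = removable _ _ λ o i eq →
    subst (λ i → letter o i ≢ max) (sym (position-first o i eq)) (below-max o {zero} {j} τ0<τj)

  last-max-removable : ∀ j → lookup τ max < lookup τ j → Removable {n} max max τ
  last-max-removable j τm<τj = removable _ _ λ o i eq →
    subst (λ i → letter o i ≢ max) (sym (position-last o i eq)) (below-max o {max} {j} τm<τj)

  first-zero-removable : ∀ j → lookup τ j < lookup τ zero → Removable {n} zero zero τ
  first-zero-removable j τj<τ0 = removable _ _ λ o i eq →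
    subst (λ i → letter o i ≢ zero) (sym (position-first o i eq)) (above-zero o {zero} {j} τj<τ0)

  first-second-max-removable : ∀ i j → lookup τ zero < lookup τ i → lookup τ i < lookup τ j →
    Removable {suc n} zero second-max τ
  first-second-max-removable i j τ0<τi τi<τj = removable _ _ λ o h eq →
    subst (λ i → letter o i ≢ second-max) (sym (position-first o h eq))
      (below-second-max o {zero} {i} {j} τ0<τi τi<τj)

-- Here "second" is the position and "max" the value, unlike in `first-second-max-removable`. The
-- second position can be met by either of the first two letters of `τ`, hence two witnesses.
second-max-removable : (τ : OneLine (suc (suc k))) → ∀ i j →
  lookup τ zero < lookup τ i → lookup τ (suc zero) < lookup τ j → Removable {suc n} (suc zero) max τ
second-max-removable τ i j τ0<τi τ1<τj = removable _ _ λ o h eq →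
  [ (λ h≡ → subst (λ i → letter o i ≢ max) (sym h≡) (below-max o {zero} {i} τ0<τi))
  , (λ h≡ → subst (λ i → letter o i ≢ max) (sym h≡) (below-max o {suc zero} {j} τ1<τj))
  ]′ (position-second o h eq)

-- The new minimum supplies the 1 in front of any 213. Conversely the last three letters of 1324
-- form a 213, whose first letter a leading minimum cannot play.
avoid-1324-insert-min : (ρ : OneLine n) → Avoid ⟨1324⟩ (insert zero zero ρ) ⇔ Avoid ⟨213⟩ ρ
avoid-1324-insert-min ρ = mk⇔ (λ av o → av (extend o)) (λ av o → av (shorten o))
  where
  extend : Occurrence ⟨213⟩ ρ → Occurrence ⟨1324⟩ (insert zero zero ρ)
  extend o = occurrence-1324 z<s (mono o′ {0F} {1F} z<s) (mono o′ {1F} {2F} (s<s z<s))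
    (≢zero⇒zero< (lookup-insert-punchIn-≢ zero zero ρ _))
    (order o′ {1F} {0F} z<s) (order o′ {0F} {2F} (s<s z<s))
    where o′ = compose o (insert-occurrence {p = zero} {v = zero})
  shorten : Occurrence ⟨1324⟩ (insert zero zero ρ) → Occurrence ⟨213⟩ ρ
  shorten o = first-zero-removable ⟨213⟩ 1F z<s (compose 213⊂1324 o)
    where
    213⊂1324 : Occurrence ⟨213⟩ ⟨1324⟩
    213⊂1324 = occurrence-213 {p = 1F} {2F} {3F} (s<s z<s) (s<s (s<s z<s)) (s<s z<s) (s<s (s<s z<s))

-- The new maximum supplies the 4 behind any 132. Conversely the first three letters of 1324 form a
-- 132, whose last letter a final maximum cannot play.
avoid-1324-insert-max : (ρ : OneLine n) → Avoid ⟨1324⟩ (insert max max ρ) ⇔ Avoid ⟨132⟩ ρ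
avoid-1324-insert-max ρ = mk⇔ (λ av o → av (extend o)) (λ av o → av (shorten o))
  where
  extend : Occurrence ⟨132⟩ ρ → Occurrence ⟨1324⟩ (insert max max ρ)
  extend o = occurrence-1324 (mono o′ {0F} {1F} z<s) (mono o′ {1F} {2F} (s<s z<s))
    (≢max⇒<max (Fin.punchInᵢ≢i max _))
    (order o′ {0F} {2F} z<s) (order o′ {2F} {1F} (s<s z<s))
    (subst (lookup (insert max max ρ) (position o′ 1F) <_) (sym (lookup-insert max max ρ))
      (≢max⇒<max (lookup-insert-punchIn-≢ max max ρ (position o 1F))))
    where o′ = compose o (insert-occurrence {p = max} {v = max})
  shorten : Occurrence ⟨1324⟩ (insert max max ρ) → Occurrence ⟨132⟩ ρ
  shorten o = last-max-removable ⟨132⟩ 1F (s<s z<s) (compose 132⊂1324 o)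
    where
    132⊂1324 : Occurrence ⟨132⟩ ⟨1324⟩
    132⊂1324 = occurrence-132 {p = 0F} {1F} {2F} z<s (s<s z<s) z<s (s<s z<s)

-- Avoiding 213 entails avoiding 2143, which is how `Av[1324,2143,2341]-insert-min` recovers its
-- 2143 component; `132⊂2143` does the same for a final maximum.
213⊂2143 : Occurrence ⟨213⟩ ⟨2143⟩
213⊂2143 = occurrence-213 {p = 0F} {1F} {2F} z<s (s<s z<s) z<s (s<s z<s)

132⊂2143 : Occurrence ⟨132⟩ ⟨2143⟩
132⊂2143 = occurrence-132 {p = 0F} {2F} {3F} z<s (s<s (s<s z<s)) (s<s z<s) (s<s (s<s z<s))

-- The avoidance classes and their forced first letters

Av[132,2341] Av[213,2341] Av[1324,2143,2341] : OneLine n → Set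
Av[132,2341]       π = Avoid ⟨132⟩ π × Avoid ⟨2341⟩ π
Av[213,2341]       π = Avoid ⟨213⟩ π × Avoid ⟨2341⟩ π
Av[1324,2143,2341] π = Avoid ⟨1324⟩ π × Avoid ⟨2143⟩ π × Avoid ⟨2341⟩ π

First≢max Last≢max First≢zero : OneLine (suc n) → Set
First≢max  π = lookup π zero ≢ max
Last≢max   π = lookup π max ≢ max
First≢zero π = lookup π zero ≢ zero

Second≢max : OneLine (suc (suc n)) → Set
Second≢max π = lookup π (suc zero) ≢ max

module _ {π : OneLine (suc n)} (perm : IsPermutation π) {m} (πm≡max : lookup π m ≡ max) where

  ≢⇒<maximum : ∀ {i} → i ≢ m → lookup π i < lookup π m
  ≢⇒<maximum i≢m = subst (_ <_) (sym πm≡max) (≢max⇒<max λ πi≡max →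
    i≢m (lookup-injective perm _ _ (trans πi≡max (sym πm≡max))))

  ≢maximum : ∀ {i} → lookup π i ≢ max → i ≢ m
  ≢maximum πi≢max refl = πi≢max πm≡max

module _ {π : OneLine (suc (suc n))} (perm : IsPermutation π) where

  -- Suppose the first letter is not the minimum. A smaller letter between it and the maximum would
  -- give 213, so the second letter is larger than the first and the minimum follows the maximum.
  -- Then first, second, maximum, minimum form 2341.
  first≡zero : Av[213,2341] π → First≢max π → Second≢max π → lookup π zero ≡ zero
  first≡zero (av₂₁₃ , av₂₃₄₁) first≢ second≢
    with lookup π zero Fin.≟ zero | lookup-surjective perm max | lookup-surjective perm zero
  ... | yes eq        | _          | _           = eq
  ... | no first≢zero | m , πm≡max | a , πa≡zero = ⊥-elim absurd
    where
    ≺m = ≢⇒<maximum perm πm≡max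
    0≢m = ≢maximum perm πm≡max first≢
    1≢m = ≢maximum perm πm≡max second≢
    a≢m : a ≢ m
    a≢m = ≢maximum perm πm≡max (λ eq → contradiction (trans (sym πa≡zero) eq) λ ())
    a≺0 : lookup π a < lookup π zero
    a≺0 = subst (_< lookup π zero) (sym πa≡zero) (≢zero⇒zero< first≢zero)
    0<a : zero {suc n} < a
    0<a = ≢zero⇒zero< λ a≡0 → first≢zero (trans (cong (lookup π) (sym a≡0)) πa≡zero)
    1<m = ≢zero∧≢one⇒one< (0≢m ∘ sym) (1≢m ∘ sym)
    absurd : ⊥
    absurd with lookup-cmp perm {zero} {suc zero} (λ ()) | Fin.<-cmp a m
    ... | inj₂ 1≺0 | _            = av₂₁₃ (occurrence-213 z<s 1<m 1≺0 (≺m 0≢m))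
    ... | inj₁ 0≺1 | tri< a<m _ _ = av₂₁₃ (occurrence-213 0<a a<m a≺0 (≺m 0≢m))
    ... | inj₁ 0≺1 | tri≈ _ a≡m _ = a≢m a≡m
    ... | inj₁ 0≺1 | tri> _ _ m<a = av₂₃₄₁ (occurrence-2341 z<s 1<m m<a a≺0 0≺1 (≺m 1≢m))

  -- Otherwise the second largest letter, at `c`, exceeds the first. Any letter above the first one
  -- and behind the maximum gives 132, so `c` precedes the maximum and the last letter is below the
  -- first. Then first, `c`, maximum, last form 2341.
  first≡second-max : Av[132,2341] π → First≢max π → Last≢max π → lookup π zero ≡ second-max
  first≡second-max (av₁₃₂ , av₂₃₄₁) first≢ last≢
    with lookup π zero Fin.≟ second-max | lookup-surjective perm max | lookup-surjective perm second-max
  ... | yes eq          | _          | _              = eq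
  ... | no first≢second | m , πm≡max | c , πc≡second = ⊥-elim absurd
    where
    ≺m = ≢⇒<maximum perm πm≡max
    0≢m = ≢maximum perm πm≡max first≢
    last≢m = ≢maximum perm πm≡max last≢
    c≢m : c ≢ m
    c≢m = ≢maximum perm πm≡max (λ eq → second≢max (trans (sym πc≡second) eq))
    0≺c : lookup π zero < lookup π c
    0≺c = subst (_ <_) (sym πc≡second) (≢max∧≢second⇒<second first≢ first≢second)
    0<c : zero {suc n} < c
    0<c = ≢zero⇒zero< λ c≡0 → first≢second (trans (cong (lookup π) (sym c≡0)) πc≡second)
    0<m = ≢zero⇒zero< (0≢m ∘ sym)
    m<last = ≢max⇒<max (last≢m ∘ sym)
    absurd : ⊥
    absurd with Fin.<-cmp c m | lookup-cmp perm {zero} {max} (λ ())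
    ... | tri≈ _ c≡m _ | _           = c≢m c≡m
    ... | tri> _ _ m<c | _           = av₁₃₂ (occurrence-132 0<m m<c 0≺c (≺m c≢m))
    ... | tri< c<m _ _ | inj₁ 0≺last = av₁₃₂ (occurrence-132 0<m m<last 0≺last (≺m last≢m))
    ... | tri< c<m _ _ | inj₂ last≺0 = av₂₃₄₁ (occurrence-2341 0<c c<m m<last last≺0 0≺c (≺m c≢m))

  -- Let x, y, M, z be the first, second, maximal and last letters. If x lies between y and z in
  -- value, then x y M z is 2143 or 2341. If x exceeds both, the second largest letter c decides: x
  -- c M z is 2341 when c precedes M, and x y M c is 2143 when it follows. If x is below both, the
  -- minimum a decides: x a M z is 2143 or x y M a is 2341.
  first≢zero⇒second-max : Av[1324,2143,2341] π → First≢max π → Second≢max π → Last≢max π →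
    First≢zero π → lookup π zero ≡ second-max
  first≢zero⇒second-max (av₁₃₂₄ , av₂₁₄₃ , av₂₃₄₁) first≢ second≢ last≢ first≢zero
    with lookup π zero Fin.≟ second-max
       | lookup-surjective perm max | lookup-surjective perm second-max | lookup-surjective perm zero
  ... | yes eq          | _          | _             | _           = eq
  ... | no first≢second | m , πm≡max | c , πc≡second | a , πa≡zero = ⊥-elim absurd
    where
    ≺m = ≢⇒<maximum perm πm≡max
    0≢m = ≢maximum perm πm≡max first≢
    1≢m = ≢maximum perm πm≡max second≢
    last≢m = ≢maximum perm πm≡max last≢
    c≢m : c ≢ m
    c≢m = ≢maximum perm πm≡max (λ eq → second≢max (trans (sym πc≡second) eq))
    a≢m : a ≢ m
    a≢m = ≢maximum perm πm≡max (λ eq → contradiction (trans (sym πa≡zero) eq) λ ())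
    0≺c : lookup π zero < lookup π c
    0≺c = subst (_ <_) (sym πc≡second) (≢max∧≢second⇒<second first≢ first≢second)
    a≺0 : lookup π a < lookup π zero
    a≺0 = subst (_< lookup π zero) (sym πa≡zero) (≢zero⇒zero< first≢zero)
    0<c : zero {suc n} < c
    0<c = ≢zero⇒zero< λ c≡0 → first≢second (trans (cong (lookup π) (sym c≡0)) πc≡second)
    0<a : zero {suc n} < a
    0<a = ≢zero⇒zero< λ a≡0 → first≢zero (trans (cong (lookup π) (sym a≡0)) πa≡zero)
    0<1 : zero {suc n} < suc (zero {n})
    0<1 = z<s
    1<m = ≢zero∧≢one⇒one< (0≢m ∘ sym) (1≢m ∘ sym)
    m<last = ≢max⇒<max (last≢m ∘ sym)
    absurd : ⊥
    absurd with lookup-cmp perm {zero} {suc zero} (λ ()) | lookup-cmp perm {zero} {max} (λ ())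
    ... | inj₂ 1≺0 | inj₁ 0≺last = av₂₁₄₃ (occurrence-2143 0<1 1<m m<last 1≺0 0≺last (≺m last≢m))
    ... | inj₁ 0≺1 | inj₂ last≺0 = av₂₃₄₁ (occurrence-2341 0<1 1<m m<last last≺0 0≺1 (≺m 1≢m))
    ... | inj₂ 1≺0 | inj₂ last≺0 with Fin.<-cmp c m
    ...   | tri< c<m _ _ = av₂₃₄₁ (occurrence-2341 0<c c<m m<last last≺0 0≺c (≺m c≢m))
    ...   | tri≈ _ c≡m _ = c≢m c≡m
    ...   | tri> _ _ m<c = av₂₁₄₃ (occurrence-2143 0<1 1<m m<c 1≺0 0≺c (≺m c≢m))
    absurd | inj₁ 0≺1 | inj₁ 0≺last with Fin.<-cmp a m
    ...   | tri< a<m _ _ = av₂₁₄₃ (occurrence-2143 0<a a<m m<last a≺0 0≺last (≺m last≢m))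
    ...   | tri≈ _ a≡m _ = a≢m a≡m
    ...   | tri> _ _ m<a = av₂₃₄₁ (occurrence-2341 0<1 1<m m<a a≺0 0≺1 (≺m 1≢m))

-- Counting

-- Counting by a duplicate-free enumeration turns bijections into `List.map` and case splits into
-- `_++_`. The number is determined by the predicate, by `count-unique`.
record Count (P : A → Set) (c : ℕ) : Set where
  field
    elements : List A
    unique   : List.Unique elements
    size     : length elements ≡ c
    sound    : ∀ {x} → x ∈ elements → P x
    complete : ∀ {x} → P x → x ∈ elements

open Count

count-unique : Count P a → Count P b → a ≡ b
count-unique p q = trans (sym (size p)) (trans (↭-length (∼bag⇒↭ bag)) (size q))
  where
  bag = unique∧set⇒bag (unique p) (unique q) (mk⇔ (complete q ∘ sound p) (complete p ∘ sound q))

count-cong : (∀ {x} → P x ⇔ Q x) → Count P a → Count Q a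
count-cong P⇔Q p = record
  { elements = elements p
  ; unique   = unique p
  ; size     = size p
  ; sound    = to P⇔Q ∘ sound p
  ; complete = complete p ∘ from P⇔Q
  }

count-empty : (∀ {x} → ¬ P x) → Count P 0
count-empty ¬P = record
  { elements = [] ; unique = [] ; size = refl ; sound = λ () ; complete = λ p → contradiction p ¬P }

count-⊎ : (∀ {x} → P x → ¬ Q x) → Count P a → Count Q b → Count (λ x → P x ⊎ Q x) (a ℕ.+ b)
count-⊎ disjoint p q = record
  { elements = elements p ++ elements q
  ; unique   = ListUnique.++⁺ (unique p) (unique q) λ (x∈p , x∈q) → disjoint (sound p x∈p) (sound q x∈q)
  ; size     = trans (length-++ (elements p)) (cong₂ ℕ._+_ (size p) (size q))
  ; sound    = Sum.map (sound p) (sound q) ∘ ∈-++⁻ (elements p)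
  ; complete = [ ∈-++⁺ˡ ∘ complete p , ∈-++⁺ʳ (elements p) ∘ complete q ]′
  }

Permutations : (OneLine n → Set) → ℕ → Set
Permutations C = Count (λ π → IsPermutation π × C π)

permutations-empty : {C : OneLine n → Set} → (∀ π → IsPermutation π → ¬ C π) → Permutations C 0
permutations-empty ¬C = count-empty λ (perm , c) → ¬C _ perm c

permutations-zero : {C : OneLine 0 → Set} → C [] → Permutations C 1
permutations-zero C[] = record
  { elements = [] ∷ []
  ; unique   = [] ∷ []
  ; size     = refl
  ; sound    = λ { (here refl) → [] , C[] }
  ; complete = λ { {[]} _ → here refl }
  }

module _ (p v : Fin (suc n)) {C : OneLine (suc n) → Set} {C′ : OneLine n → Set}
         (C⇔C′ : ∀ ρ → C (insert p v ρ) ⇔ C′ ρ) where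

  remove-letter : (∀ {π} → IsPermutation π → C π → lookup π p ≡ v) → Permutations C′ a → Permutations C a
  remove-letter forced q = record
    { elements = List.map (insert p v) (elements q)
    ; unique   = ListUnique.map⁺ (insert-injective p v) (unique q)
    ; size     = trans (length-map (insert p v) (elements q)) (size q)
    ; sound    = sound′
    ; complete = complete′
    }
    where
    sound′ : ∀ {π} → π ∈ List.map (insert p v) (elements q) → IsPermutation π × C π
    sound′ π∈ with ρ , ρ∈ , refl ← ∈-map⁻ (insert p v) π∈ with perm , c ← sound q ρ∈ =
      insert-permutation p v perm , from (C⇔C′ ρ) c
    complete′ : ∀ {π} → IsPermutation π × C π → π ∈ List.map (insert p v) (elements q)
    complete′ (perm , c) with ρ , perm′ , refl ← insert-surjective p v perm (forced perm c) =
      ∈-map⁺ (insert p v) (complete q (perm′ , to (C⇔C′ ρ) c))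

module _ (p v : Fin (suc n)) {C : OneLine (suc n) → Set} {C′ : OneLine n → Set}
         (C⇔C′ : ∀ ρ → C (insert p v ρ) ⇔ C′ ρ) where

  -- Peels off the permutations with `v` at `p` and records the inequality for the rest. It is
  -- iterated until the residual class is one already counted or has a forced letter, where
  -- `remove-letter` takes over.
  split-letter : Permutations C′ a → Permutations (λ π → C π × lookup π p ≢ v) b →
    Permutations C (a ℕ.+ b)
  split-letter q r = count-cong (mk⇔ join split)
    (count-⊎ (λ (_ , _ , eq) (_ , _ , neq) → neq eq)
      (remove-letter p v {C = λ π → C π × lookup π p ≡ v}
        (λ ρ → mk⇔ (to (C⇔C′ ρ) ∘ proj₁) (λ c → from (C⇔C′ ρ) c , lookup-insert p v ρ))
        (λ _ → proj₂) q)
      r)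
    where
    join : ∀ {π} → (IsPermutation π × C π × lookup π p ≡ v) ⊎ (IsPermutation π × C π × lookup π p ≢ v) →
      IsPermutation π × C π
    join (inj₁ (perm , c , _)) = perm , c
    join (inj₂ (perm , c , _)) = perm , c
    split : ∀ {π} → IsPermutation π × C π →
      (IsPermutation π × C π × lookup π p ≡ v) ⊎ (IsPermutation π × C π × lookup π p ≢ v)
    split {π} (perm , c) with lookup π p Fin.≟ v
    ... | yes eq = inj₁ (perm , c , eq)
    ... | no neq = inj₂ (perm , c , neq)

-- Inserting a smaller value keeps the old maximum maximal, so its position merely moves along
-- `punchIn p`. With `p = zero` and `j = zero` this exchanges `Second≢max` above for `First≢max`
-- below.
≢max-insert : ∀ (p v : Fin (suc (suc n))) (ρ : OneLine (suc n)) j → v ≢ max →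
  lookup (insert p v ρ) (punchIn p j) ≢ max ⇔ lookup ρ j ≢ max
≢max-insert p v ρ j v≢max = mk⇔
  (λ ≢max eq → ≢max (trans (lookup-insert-punchIn p v ρ j) (trans (cong (punchIn v) eq) (punchIn-max v≢max))))
  (λ ≢max eq → ≢max (Fin.punchIn-injective v _ _
    (trans (sym (lookup-insert-punchIn p v ρ j)) (trans eq (sym (punchIn-max v≢max))))))

module _ (p v : Fin (suc n)) (ρ : OneLine n) where

  Av[132,2341]-insert : Removable p v ⟨132⟩ → Removable p v ⟨2341⟩ →
    Av[132,2341] (insert p v ρ) ⇔ Av[132,2341] ρ
  Av[132,2341]-insert r s = avoid-insert p v r ρ ×-⇔ avoid-insert p v s ρ

  Av[213,2341]-insert : Removable p v ⟨213⟩ → Removable p v ⟨2341⟩ →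
    Av[213,2341] (insert p v ρ) ⇔ Av[213,2341] ρ
  Av[213,2341]-insert r s = avoid-insert p v r ρ ×-⇔ avoid-insert p v s ρ

  Av[1324,2143,2341]-insert : Removable p v ⟨1324⟩ → Removable p v ⟨2143⟩ → Removable p v ⟨2341⟩ →
    Av[1324,2143,2341] (insert p v ρ) ⇔ Av[1324,2143,2341] ρ
  Av[1324,2143,2341]-insert r s t = avoid-insert p v r ρ ×-⇔ avoid-insert p v s ρ ×-⇔ avoid-insert p v t ρ

Av[1324,2143,2341]-insert-min : (ρ : OneLine n) →
  Av[1324,2143,2341] (insert zero zero ρ) ⇔ Av[213,2341] ρ
Av[1324,2143,2341]-insert-min ρ = mk⇔
  (λ (av₁₃₂₄ , _ , av₂₃₄₁) → to (avoid-1324-insert-min ρ) av₁₃₂₄ , to avoid-2341 av₂₃₄₁)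
  (λ (av₂₁₃ , av₂₃₄₁) → from (avoid-1324-insert-min ρ) av₂₁₃ ,
    from (avoid-insert zero zero (first-zero-removable ⟨2143⟩ 1F z<s) ρ) (av₂₁₃ ∘ compose 213⊂2143) ,
    from avoid-2341 av₂₃₄₁)
  where
  avoid-2341 = avoid-insert zero zero (first-zero-removable ⟨2341⟩ 3F z<s) ρ

Av[1324,2143,2341]-insert-max : (ρ : OneLine n) →
  Av[1324,2143,2341] (insert max max ρ) ⇔ Av[132,2341] ρ
Av[1324,2143,2341]-insert-max ρ = mk⇔
  (λ (av₁₃₂₄ , _ , av₂₃₄₁) → to (avoid-1324-insert-max ρ) av₁₃₂₄ , to avoid-2341 av₂₃₄₁)
  (λ (av₁₃₂ , av₂₃₄₁) → from (avoid-1324-insert-max ρ) av₁₃₂ ,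
    from (avoid-insert max max (last-max-removable ⟨2143⟩ 2F (s<s (s<s z<s))) ρ) (av₁₃₂ ∘ compose 132⊂2143) ,
    from avoid-2341 av₂₃₄₁)
  where
  avoid-2341 = avoid-insert max max (last-max-removable ⟨2341⟩ 0F z<s) ρ

-- Recurrences

-- w, u and v are indexed by one less than the size of the permutations they count.
f w u v s : ℕ → ℕ

f zero    = 1
f (suc n) = f n ℕ.+ w n

w zero    = 0
w (suc n) = f (suc n) ℕ.+ w n

v zero          = 0
-- In size 2 the second position is the last one, so a maximum there is already excluded and the
-- recurrences of `v` and `u` start at size 3.
v (suc zero)    = 0
v (suc (suc n)) = f (suc (suc n)) ℕ.+ v (suc n)

u zero          = 0
u (suc zero)    = 0
u (suc (suc n)) = s (suc (suc n)) ℕ.+ (v (suc n) ℕ.+ u (suc n))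

s zero          = 1
-- In size 1 the first and last positions coincide; the general rule would count the maximum at both
-- ends.
s (suc zero)    = 1
s (suc (suc n)) = s (suc n) ℕ.+ (f (suc n) ℕ.+ u (suc n))

-- Neither pattern ends in its largest letter, so a final maximum is deleted freely. The values of
-- `f` are 1, 1, 2, 5, 13, 34: every other Fibonacci number.
count-Av[132,2341] : ∀ n → Permutations {n} Av[132,2341] (f n)
count-Av[132,2341]-last≢max : ∀ n → Permutations {suc n} (λ π → Av[132,2341] π × Last≢max π) (w n)

count-Av[132,2341] zero = permutations-zero
  ((λ o → Fin.¬Fin0 (position o 0F)) , λ o → Fin.¬Fin0 (position o 0F))
count-Av[132,2341] (suc n) = split-letter max max
  (λ ρ → Av[132,2341]-insert max max ρ
    (last-max-removable ⟨132⟩ 1F (s<s z<s)) (last-max-removable ⟨2341⟩ 0F z<s))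
  (count-Av[132,2341] n) (count-Av[132,2341]-last≢max n)

one-letter : (π : OneLine 1) → lookup π 0F ≡ 0F
one-letter (0F ∷ []) = refl

count-Av[132,2341]-last≢max zero = permutations-empty λ π _ (_ , last≢) → last≢ (one-letter π)
count-Av[132,2341]-last≢max (suc n) = split-letter zero max
  (λ ρ → let av⇔ = Av[132,2341]-insert zero max ρ (first-max-removable ⟨132⟩ 1F z<s)
                     (first-max-removable ⟨2341⟩ 1F (s<s z<s)) in
    mk⇔ (to av⇔ ∘ proj₁) (λ av → from av⇔ av , lookup-insert-punchIn-≢ zero max ρ max))
  (count-Av[132,2341] (suc n))
  -- The deleted letter accounts for `First≢max` by itself; the shorter permutation may start with
  -- its maximum, and only the condition on the last letter survives.
  (remove-letter zero second-max
    (λ ρ → let av⇔ = Av[132,2341]-insert zero second-max ρ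
                       (first-second-max-removable ⟨132⟩ 2F 1F z<s (s<s z<s))
                       (first-second-max-removable ⟨2341⟩ 1F 2F (s<s z<s) (s<s (s<s z<s))) in
      mk⇔ (λ ((av , last≢) , _) →
            to av⇔ av , to (≢max-insert zero second-max ρ max second≢max) last≢)
          (λ (av , last≢) →
            (from av⇔ av , from (≢max-insert zero second-max ρ max second≢max) last≢) , second≢max))
    (λ perm ((av , last≢) , first≢) → first≡second-max perm av first≢ last≢)
    (count-Av[132,2341]-last≢max n))

-- Reflection in the antidiagonal (reversal, complement and inverse combined) exchanges 132 with 213
-- and fixes 2341, which explains the common `f`. The count is nevertheless made directly, from the
-- same recurrences.
count-Av[213,2341] : ∀ n → Permutations {n} Av[213,2341] (f n)
count-Av[213,2341]-first≢max : ∀ n → Permutations {suc n} (λ π → Av[213,2341] π × First≢max π) (w n)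

count-Av[213,2341] zero = permutations-zero
  ((λ o → Fin.¬Fin0 (position o 0F)) , λ o → Fin.¬Fin0 (position o 0F))
count-Av[213,2341] (suc n) = split-letter zero max
  (λ ρ → Av[213,2341]-insert zero max ρ (first-max-removable ⟨213⟩ 2F (s<s z<s))
           (first-max-removable ⟨2341⟩ 1F (s<s z<s)))
  (count-Av[213,2341] n) (count-Av[213,2341]-first≢max n)

Av[213,2341]-insert-second-max : (ρ : OneLine (suc n)) →
  Av[213,2341] (insert (suc zero) max ρ) ⇔ Av[213,2341] ρ
Av[213,2341]-insert-second-max ρ = Av[213,2341]-insert (suc zero) max ρ
  (second-max-removable ⟨213⟩ 2F 2F (s<s z<s) z<s)
  (second-max-removable ⟨2341⟩ 2F 2F (s<s z<s) (s<s (s<s z<s)))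

Av[213,2341]-insert-min : (ρ : OneLine n) → Av[213,2341] (insert zero zero ρ) ⇔ Av[213,2341] ρ
Av[213,2341]-insert-min ρ = Av[213,2341]-insert zero zero ρ
  (first-zero-removable ⟨213⟩ 1F z<s) (first-zero-removable ⟨2341⟩ 3F z<s)

count-Av[213,2341]-first≢max zero = permutations-empty λ π _ (_ , first≢) → first≢ (one-letter π)
count-Av[213,2341]-first≢max (suc n) = split-letter (suc zero) max
  (λ ρ → mk⇔ (to (Av[213,2341]-insert-second-max ρ) ∘ proj₁)
             (λ av → from (Av[213,2341]-insert-second-max ρ) av , lookup-insert-punchIn-≢ (suc zero) max ρ zero))
  (count-Av[213,2341] (suc n))
  -- A leading minimum satisfies `First≢max` by itself, and its deletion turns `Second≢max` into
  -- `First≢max`.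
  (remove-letter zero zero
    (λ ρ → mk⇔ (λ ((av , _) , second≢) →
                 to (Av[213,2341]-insert-min ρ) av , to (≢max-insert zero zero ρ zero λ ()) second≢)
               (λ (av , first≢) →
                 (from (Av[213,2341]-insert-min ρ) av , λ ()) , from (≢max-insert zero zero ρ zero λ ()) first≢))
    (λ perm ((av , first≢) , second≢) → first≡zero perm av first≢ second≢)
    (count-Av[213,2341]-first≢max n))

one-letter-max : (π : OneLine 1) → ¬ First≢max π
one-letter-max π first≢ = first≢ (one-letter π)

two-letter-max : {π : OneLine 2} → IsPermutation π → First≢max π → ¬ Last≢max π
two-letter-max perm first≢ last≢ with lookup-surjective perm max
... | 0F , eq = first≢ eq
... | 1F , eq = last≢ eq

-- This is the class left in the main count when a leading minimum is deleted and the maximum was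
-- neither second nor last.
count-Av[213,2341]-ends≢max : ∀ n →
  Permutations {suc n} (λ π → Av[213,2341] π × First≢max π × Last≢max π) (v n)
count-Av[213,2341]-ends≢max zero = permutations-empty λ π _ (_ , first≢ , _) → one-letter-max π first≢
count-Av[213,2341]-ends≢max (suc zero) = permutations-empty λ _ perm (_ , first≢ , last≢) →
  two-letter-max perm first≢ last≢
count-Av[213,2341]-ends≢max (suc (suc n)) = split-letter (suc zero) max
  (λ ρ → mk⇔ (to (Av[213,2341]-insert-second-max ρ) ∘ proj₁)
             (λ av → from (Av[213,2341]-insert-second-max ρ) av ,
               lookup-insert-punchIn-≢ (suc zero) max ρ zero , lookup-insert-punchIn-≢ (suc zero) max ρ max))
  (count-Av[213,2341] (suc (suc n)))
  (remove-letter zero zero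
    (λ ρ → mk⇔ (λ ((av , _ , last≢) , second≢) → to (Av[213,2341]-insert-min ρ) av ,
                 to (≢max-insert zero zero ρ zero λ ()) second≢ , to (≢max-insert zero zero ρ max λ ()) last≢)
               (λ (av , first≢ , last≢) →
                 (from (Av[213,2341]-insert-min ρ) av , (λ ()) , from (≢max-insert zero zero ρ max λ ()) last≢) ,
                 from (≢max-insert zero zero ρ zero λ ()) first≢))
    (λ perm ((av , first≢ , _) , second≢) → first≡zero perm av first≢ second≢)
    (count-Av[213,2341]-ends≢max (suc n)))

-- The summands belong to the maximum in first place, in last place and at neither end. Only the
-- last place changes the class, because 1324 alone among the three patterns ends in its largest
-- letter.
count-Av[1324,2143,2341] : ∀ n → Permutations {n} Av[1324,2143,2341] (s n)
count-Av[1324,2143,2341]-ends≢max : ∀ n →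
  Permutations {suc n} (λ π → Av[1324,2143,2341] π × First≢max π × Last≢max π) (u n)

count-Av[1324,2143,2341] zero = permutations-zero
  ((λ o → Fin.¬Fin0 (position o 0F)) , (λ o → Fin.¬Fin0 (position o 0F)) , λ o → Fin.¬Fin0 (position o 0F))
count-Av[1324,2143,2341] (suc zero) = remove-letter zero zero
  Av[1324,2143,2341]-insert-min (λ {π} _ _ → one-letter π) (count-Av[213,2341] 0)
count-Av[1324,2143,2341] (suc (suc n)) = split-letter zero max
  (λ ρ → Av[1324,2143,2341]-insert zero max ρ (first-max-removable ⟨1324⟩ 1F z<s)
           (first-max-removable ⟨2143⟩ 2F (s<s z<s)) (first-max-removable ⟨2341⟩ 1F (s<s z<s)))
  (count-Av[1324,2143,2341] (suc n))
  (split-letter max max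
    (λ ρ → mk⇔ (to (Av[1324,2143,2341]-insert-max ρ) ∘ proj₁)
               (λ av → from (Av[1324,2143,2341]-insert-max ρ) av , lookup-insert-punchIn-≢ max max ρ zero))
    (count-Av[132,2341] (suc n))
    (count-cong (mk⇔ (λ (perm , av , first≢ , last≢) → perm , (av , first≢) , last≢)
                     (λ (perm , (av , first≢) , last≢) → perm , av , first≢ , last≢))
      (count-Av[1324,2143,2341]-ends≢max (suc n))))

count-Av[1324,2143,2341]-ends≢max zero = permutations-empty λ π _ (_ , first≢ , _) → one-letter-max π first≢
count-Av[1324,2143,2341]-ends≢max (suc zero) = permutations-empty λ _ perm (_ , first≢ , last≢) →
  two-letter-max perm first≢ last≢
count-Av[1324,2143,2341]-ends≢max (suc (suc n)) = split-letter (suc zero) max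
  (λ ρ → let av⇔ = Av[1324,2143,2341]-insert (suc zero) max ρ
                     (second-max-removable ⟨1324⟩ 1F 3F z<s (s<s (s<s z<s)))
                     (second-max-removable ⟨2143⟩ 2F 2F (s<s z<s) z<s)
                     (second-max-removable ⟨2341⟩ 2F 2F (s<s z<s) (s<s (s<s z<s))) in
    mk⇔ (to av⇔ ∘ proj₁)
        (λ av → from av⇔ av ,
          lookup-insert-punchIn-≢ (suc zero) max ρ zero , lookup-insert-punchIn-≢ (suc zero) max ρ max))
  (count-Av[1324,2143,2341] (suc (suc n)))
  (split-letter zero zero
    (λ ρ → mk⇔ (λ ((av , _ , last≢) , second≢) → to (Av[1324,2143,2341]-insert-min ρ) av ,
                 to (≢max-insert zero zero ρ zero λ ()) second≢ , to (≢max-insert zero zero ρ max λ ()) last≢)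
               (λ (av , first≢ , last≢) →
                 (from (Av[1324,2143,2341]-insert-min ρ) av , (λ ()) , from (≢max-insert zero zero ρ max λ ()) last≢) ,
                 from (≢max-insert zero zero ρ zero λ ()) first≢))
    (count-Av[213,2341]-ends≢max (suc n))
    -- There are at least three letters here, so `second-max` is not `zero`; the closing `λ ()` of
    -- the converse rests on this.
    (remove-letter zero second-max
      (λ ρ → let av⇔ = Av[1324,2143,2341]-insert zero second-max ρ
                         (first-second-max-removable ⟨1324⟩ 2F 1F z<s (s<s z<s))
                         (first-second-max-removable ⟨2143⟩ 3F 2F (s<s z<s) (s<s (s<s z<s)))
                         (first-second-max-removable ⟨2341⟩ 1F 2F (s<s z<s) (s<s (s<s z<s))) in
        mk⇔ (λ (((av , _ , last≢) , second≢) , _) → to av⇔ av ,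
              to (≢max-insert zero second-max ρ zero second≢max) second≢ ,
              to (≢max-insert zero second-max ρ max second≢max) last≢)
            (λ (av , first≢ , last≢) →
              ((from av⇔ av , second≢max , from (≢max-insert zero second-max ρ max second≢max) last≢) ,
               from (≢max-insert zero second-max ρ zero second≢max) first≢) , λ ()))
      (λ perm (((av , first≢ , last≢) , second≢) , first≢zero) →
        first≢zero⇒second-max perm av first≢ second≢ last≢ first≢zero)
      (count-Av[1324,2143,2341]-ends≢max (suc n))))

T : List Pattern
T = (4 , 0F ∷ 2F ∷ 1F ∷ 3F ∷ []) ∷ (4 , 1F ∷ 0F ∷ 3F ∷ 2F ∷ []) ∷ (4 , 1F ∷ 2F ∷ 3F ∷ 0F ∷ []) ∷ []

F≗s : F T ≗ λ n → + s n
F≗s n = cong +_ (count-unique avoiders (count-Av[1324,2143,2341] n))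
  where
  contains⇔₁ : {π : OneLine n} → Contains π ⟨1324⟩ ⇔ Occurrence ⟨1324⟩ π
  contains⇔₁ = contains⇔occurrence (toWitness {a? = isPermutation? ⟨1324⟩} _)
  contains⇔₂ : {π : OneLine n} → Contains π ⟨2143⟩ ⇔ Occurrence ⟨2143⟩ π
  contains⇔₂ = contains⇔occurrence (toWitness {a? = isPermutation? ⟨2143⟩} _)
  contains⇔₃ : {π : OneLine n} → Contains π ⟨2341⟩ ⇔ Occurrence ⟨2341⟩ π
  contains⇔₃ = contains⇔occurrence (toWitness {a? = isPermutation? ⟨2341⟩} _)
  avoids⇔ : {π : OneLine n} → Avoids T π ⇔ Av[1324,2143,2341] π
  avoids⇔ = mk⇔
    (λ { (av₁ ∷ av₂ ∷ av₃ ∷ []) → av₁ ∘ from contains⇔₁ , av₂ ∘ from contains⇔₂ , av₃ ∘ from contains⇔₃ })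
    (λ (av₁ , av₂ , av₃) → (av₁ ∘ to contains⇔₁) ∷ (av₂ ∘ to contains⇔₂) ∷ (av₃ ∘ to contains⇔₃) ∷ [])
  avoiders : Permutations {n} Av[1324,2143,2341] (length (S n T))
  avoiders = record
    { elements = S n T
    ; unique   = S-unique n T
    ; size     = refl
    ; sound    = λ {π} π∈S → let perm , av = to (∈-S⇔ T π) π∈S in perm , to avoids⇔ av
    ; complete = λ {π} (perm , av) → from (∈-S⇔ T π) (perm , from avoids⇔ av)
    }

-- The generating function

[]-* : ∀ h n → (poly [] * h) n ≡ 0ℤ
[]-* h n = sum-replicate-zero (suc n)

*-congˡ : ∀ {p q} h → p ≗ q → p * h ≗ q * h
*-congˡ h p≗q n = sum-cong-≗ {suc n} λ i → cong (ℤ._* h (n ∸ toℕ i)) (p≗q (toℕ i))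

VanishesFrom : ℕ → PowerSeries → Set
VanishesFrom d p = ∀ {n} → d ℕ.≤ n → p n ≡ 0ℤ

-- At a successor index the product with `a ∷ as` is one term plus the product with `as` one index
-- lower, so each listed coefficient costs one index.
*-vanishes : ∀ {p d} as → VanishesFrom d p → VanishesFrom (length as ℕ.+ d) (poly as * p)
*-vanishes {p} []       p≡0 {n} _ = []-* p n
*-vanishes     (a ∷ as) p≡0 (ℕ.s≤s d≤n) = cong₂ ℤ._+_
  (trans (cong (a ℤ.*_) (p≡0 (ℕ.m≤n⇒m≤1+n (ℕ.m+n≤o⇒n≤o (length as) d≤n)))) (ℤ.*-zeroʳ a))
  (*-vanishes as p≡0 d≤n)

denominator : PowerSeries
denominator = poly (+ 1 ∷ - + 1 ∷ []) * poly (+ 1 ∷ - + 3 ∷ + 1 ∷ []) ^ 2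

-- The bound is 2 + 3 + 3 + 1, adding numbers of coefficients and not degrees. It exceeds the true
-- degree 5, so the coefficients in between are evaluated separately.
denominator-vanishes : VanishesFrom 9 denominator
denominator-vanishes = *-vanishes (+ 1 ∷ - + 1 ∷ [])
  (*-vanishes (+ 1 ∷ - + 3 ∷ + 1 ∷ []) (*-vanishes (+ 1 ∷ - + 3 ∷ + 1 ∷ []) one-vanishes))
  where
  one-vanishes : VanishesFrom 1 (poly (1ℤ ∷ []))
  one-vanishes (ℕ.s≤s _) = refl

-- In expanded form the product with `s` unfolds at a symbolic index into six explicit terms, the
-- shape that `recurrence` has.
denominator-coefficients : denominator ≗ poly (+ 1 ∷ - + 7 ∷ + 17 ∷ - + 17 ∷ + 7 ∷ - + 1 ∷ [])
denominator-coefficients 0 = refl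
denominator-coefficients 1 = refl
denominator-coefficients 2 = refl
denominator-coefficients 3 = refl
denominator-coefficients 4 = refl
denominator-coefficients 5 = refl
denominator-coefficients 6 = refl
denominator-coefficients 7 = refl
denominator-coefficients 8 = refl
denominator-coefficients (suc (suc (suc (suc (suc (suc (suc (suc (suc n))))))))) =
  denominator-vanishes (ℕ.m≤m+n 9 n)

-- Cayley-Hamilton for the five-dimensional system. Its matrix is block triangular: the pairs (f, w)
-- and (s, u) carry the same block with rows (1, 1) and (1, 2), whose characteristic polynomial is
-- t^2 - 3t + 1, and v carries the eigenvalue 1. This is where the factor 1 - x and the square in
-- the denominator come from.
recurrence : ∀ s₀ f₀ w₀ u₀ v₀ →
  let f₁ = f₀ ℤ.+ w₀ ; w₁ = f₁ ℤ.+ w₀ ; s₁ = s₀ ℤ.+ (f₀ ℤ.+ u₀) ; u₁ = s₁ ℤ.+ (v₀ ℤ.+ u₀) ; v₁ = f₁ ℤ.+ v₀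
      f₂ = f₁ ℤ.+ w₁ ; w₂ = f₂ ℤ.+ w₁ ; s₂ = s₁ ℤ.+ (f₁ ℤ.+ u₁) ; u₂ = s₂ ℤ.+ (v₁ ℤ.+ u₁) ; v₂ = f₂ ℤ.+ v₁
      f₃ = f₂ ℤ.+ w₂ ; w₃ = f₃ ℤ.+ w₂ ; s₃ = s₂ ℤ.+ (f₂ ℤ.+ u₂) ; u₃ = s₃ ℤ.+ (v₂ ℤ.+ u₂) ; v₃ = f₃ ℤ.+ v₂
      f₄ = f₃ ℤ.+ w₃ ; s₄ = s₃ ℤ.+ (f₃ ℤ.+ u₃) ; u₄ = s₄ ℤ.+ (v₃ ℤ.+ u₃)
      s₅ = s₄ ℤ.+ (f₄ ℤ.+ u₄)
  in + 1 ℤ.* s₅ ℤ.+ (- + 7 ℤ.* s₄ ℤ.+ (+ 17 ℤ.* s₃ ℤ.+ (- + 17 ℤ.* s₂ ℤ.+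
      (+ 7 ℤ.* s₁ ℤ.+ (- + 1 ℤ.* s₀ ℤ.+ 0ℤ))))) ≡ 0ℤ
recurrence = solve-∀

denominator*s : denominator * (λ n → + s n) ≗ poly (+ 1 ∷ - + 6 ∷ + 12 ∷ - + 8 ∷ + 3 ∷ - + 1 ∷ [])
denominator*s n = trans (*-congˡ (λ n → + s n) denominator-coefficients n) (coefficient n)
  where
  coefficient : poly (+ 1 ∷ - + 7 ∷ + 17 ∷ - + 17 ∷ + 7 ∷ - + 1 ∷ []) * (λ n → + s n)
    ≗ poly (+ 1 ∷ - + 6 ∷ + 12 ∷ - + 8 ∷ + 3 ∷ - + 1 ∷ [])
  coefficient 0 = refl
  coefficient 1 = refl
  coefficient 2 = refl
  coefficient 3 = refl
  coefficient 4 = refl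
  coefficient 5 = refl
  -- From index 6 on, only values of `s` at positive indices occur, and from index 1 all five
  -- recurrences hold uniformly. Since `+_` commutes with addition by computation, the integer
  -- expressions in `recurrence` are the casts of these values.
  coefficient (suc (suc (suc (suc (suc (suc n)))))) rewrite []-* (λ n → + s n) n =
    recurrence (+ s (suc n)) (+ f (suc n)) (+ w (suc n)) (+ u (suc n)) (+ v (suc n))

s≗quotient : (λ n → + s n) ≗ poly (+ 1 ∷ - + 6 ∷ + 12 ∷ - + 8 ∷ + 3 ∷ - + 1 ∷ []) / denominator
s≗quotient = /-unique _ denominator (λ n → + s n) denominator*s

theorem8 : F ( (4 , 0F ∷ 2F ∷ 1F ∷ 3F ∷ [])
    ∷ (4 , 1F ∷ 0F ∷ 3F ∷ 2F ∷ [])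
    ∷ (4 , 1F ∷ 2F ∷ 3F ∷ 0F ∷ [])
    ∷ [])
    ≗ poly (+ 1 ∷ - + 6 ∷ + 12 ∷ - + 8 ∷ + 3 ∷ - + 1 ∷ [])
    / (poly (+ 1 ∷ - + 1 ∷ []) * poly (+ 1 ∷ - + 3 ∷ + 1 ∷ []) ^ 2)
theorem8 n = trans (F≗s n) (s≗quotient n)
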